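{- There is an absolute constant $C>0$ such that for all integers $k\geq2$, \[ \lceil C\cdot 1073^{k/6}\rceil\nrightarrow(3)^2_k. \]
   Context: For $m\in\mathbb N$ write $[m]=\{0,\dots,m-1\}$. For $n\geq 3$, $k\geq 2$, the relation $n\to(3)_k^2$ means that every colouring of the edges of the complete graph on $[n]$ with $k$ colours contains a monochromatic triangle; $n\nrightarrow(3)_k^2$ is its negation. -}

module Defs where

open import Data.Nat as ℕ using (ℕ; zero; suc)
import Data.Nat.Properties as ℕ
open import Data.Integer as ℤ using (ℤ; +_; +≤+; +<+)
import Data.Integer.Properties as ℤ
open import Data.Rational.Unnormalised
open import Data.Rational.Unnormalised.Properties
import Data.Rational.Unnormalised.Solver as ℚᵘ-Solver
open import Data.Fin as Fin using (Fin)
import Data.Fin.Properties as Fin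
open import Data.Product using (∃; ∃-syntax; _×_; _,_)
open import Data.Sum using (inj₁; inj₂)
open import Relation.Nullary using (¬_; yes; no)
open import Relation.Binary.PropositionalEquality using (_≡_; refl; cong)

-- Real numbers, as Cauchy sequences of rationals.  Two sequences may
-- represent the same real; the relations below respect this.

IsCauchy : (ℕ → ℚᵘ) → Set
IsCauchy f = ∀ ε → 0ℚᵘ < ε → ∃[ N ] ∀ m n → N ℕ.≤ m → N ℕ.≤ n → ∣ f m - f n ∣ ≤ ε

record ℝ : Set where
  constructor mkℝ
  field
    seq    : ℕ → ℚᵘ
    cauchy : IsCauchy seq

open ℝ public

infix 4 _<ᴿ_ _≤ᴿ_

_<ᴿ_ : ℝ → ℝ → Set
x <ᴿ y = ∃[ ε ] 0ℚᵘ < ε × ∃[ N ] ∀ n → N ℕ.≤ n → seq x n + ε ≤ seq y n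

_≤ᴿ_ : ℝ → ℝ → Set
x ≤ᴿ y = ¬ (y <ᴿ x)

fromℚ : ℚᵘ → ℝ
fromℚ q = mkℝ (λ _ → q) λ ε 0<ε → 0 , λ _ _ _ _ →
  ≤-trans (≤-reflexive (∣-∣-cong (+-inverseʳ q))) (<⇒≤ 0<ε)

fromℤ : ℤ → ℝ
fromℤ z = fromℚ (z / 1)

0ᴿ : ℝ
0ᴿ = fromℤ (+ 0)

-- Integer ceiling, as a relation: it is not computable from a Cauchy
-- sequence.
IsCeiling : ℝ → ℤ → Set
IsCeiling x z = (fromℤ (z ℤ.- + 1) <ᴿ x) × (x ≤ᴿ fromℤ z)

private
  eventuallyBounded : ∀ x → ∃[ A ] 0ℚᵘ < A × ∃[ N ] ∀ n → N ℕ.≤ n → ∣ seq x n ∣ ≤ A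
  eventuallyBounded x with cauchy x 1ℚᵘ (*<* (+<+ (ℕ.s≤s ℕ.z≤n)))
  ... | N , close = ∣ a ∣ + 1ℚᵘ , A>0 , N , bound
    where
    a = seq x N
    A>0 : 0ℚᵘ < ∣ a ∣ + 1ℚᵘ
    A>0 = <-respˡ-≃ (+-identityˡ 0ℚᵘ)
            (+-mono-≤-< {0ℚᵘ} {∣ a ∣} {0ℚᵘ} {1ℚᵘ} (0≤∣p∣ a) (*<* (+<+ (ℕ.s≤s ℕ.z≤n))))
    bound : ∀ n → N ℕ.≤ n → ∣ seq x n ∣ ≤ ∣ a ∣ + 1ℚᵘ
    bound n N≤n = begin
      ∣ seq x n ∣             ≃⟨ ∣-∣-cong (split (seq x n) a) ⟩
      ∣ a + (seq x n - a) ∣   ≤⟨ ∣p+q∣≤∣p∣+∣q∣ a (seq x n - a) ⟩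
      ∣ a ∣ + ∣ seq x n - a ∣ ≤⟨ +-monoʳ-≤ ∣ a ∣ (close n N N≤n ℕ.≤-refl) ⟩
      ∣ a ∣ + 1ℚᵘ             ∎
      where
      open ≤-Reasoning
      open ℚᵘ-Solver.+-*-Solver
      split : ∀ p q → p ≃ q + (p - q)
      split = solve 2 (λ p q → p := q :+ (p :- q)) ≃-refl

  quotient : ∀ A δ → 0ℚᵘ < A → 0ℚᵘ < δ → ∃[ η ] 0ℚᵘ < η × A * η ≃ δ
  quotient A δ 0<A 0<δ = δ * 1/A , positive⁻¹ (δ * 1/A) {{pos*pos⇒pos δ 1/A}} , (begin
      A * (δ * 1/A)   ≈⟨ rearrange A δ 1/A ⟩
      δ * (A * 1/A)   ≈⟨ *-congˡ {δ} (*-inverseʳ A) ⟩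
      δ * 1ℚᵘ         ≈⟨ *-identityʳ δ ⟩
      δ               ∎)
    where
    open ≃-Reasoning
    open ℚᵘ-Solver.+-*-Solver
    instance
      A-pos = positive 0<A
      δ-pos = positive 0<δ
      A≢0   = pos⇒nonZero A
    1/A = 1/ A
    instance
      1/A-pos = 1/pos⇒pos A
    rearrange : ∀ p q r → p * (q * r) ≃ q * (p * r)
    rearrange = solve 3 (λ p q r → p :* (q :* r) := q :* (p :* r)) ≃-refl

  *-mono-∣∣ : ∀ p q {A η} → ∣ p ∣ ≤ A → ∣ q ∣ ≤ η → ∣ p * q ∣ ≤ A * η
  *-mono-∣∣ p q p≤A q≤η = ≤-trans (≤-reflexive (∣p*q∣≃∣p∣*∣q∣ p q))
    (*-mono-≤-nonNeg {{∣-∣-nonNeg p}} {{∣-∣-nonNeg q}} p≤A q≤η)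

infixl 7 _*ᴿ_

_*ᴿ_ : ℝ → ℝ → ℝ
x *ᴿ y = mkℝ (λ n → seq x n * seq y n) prod-cauchy
  where
  prod-cauchy : IsCauchy (λ n → seq x n * seq y n)
  prod-cauchy ε 0<ε
    with eventuallyBounded x | eventuallyBounded y
  ... | A , 0<A , N₁ , x≤A | B , 0<B , N₂ , y≤B
    with quotient A (½ * ε) 0<A ε/2>0 | quotient B (½ * ε) 0<B ε/2>0
    where
    ε/2>0 = positive⁻¹ (½ * ε) {{pos*pos⇒pos ½ ε {{positive 0<ε}}}}
  ... | α , 0<α , Aα | β , 0<β , Bβ
    with cauchy x β 0<β | cauchy y α 0<α
  ... | N₃ , x-close | N₄ , y-close = (N₁ ℕ.⊔ N₂) ℕ.⊔ (N₃ ℕ.⊔ N₄) , λ m n N≤m N≤n →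
    let
      ⊔≤m = ℕ.≤-trans (ℕ.m≤m⊔n (N₁ ℕ.⊔ N₂) (N₃ ℕ.⊔ N₄)) N≤m
      ⊔≤n = ℕ.≤-trans (ℕ.m≤m⊔n (N₁ ℕ.⊔ N₂) (N₃ ℕ.⊔ N₄)) N≤n
      ⊔≤m′ = ℕ.≤-trans (ℕ.m≤n⊔m (N₁ ℕ.⊔ N₂) (N₃ ℕ.⊔ N₄)) N≤m
      ⊔≤n′ = ℕ.≤-trans (ℕ.m≤n⊔m (N₁ ℕ.⊔ N₂) (N₃ ℕ.⊔ N₄)) N≤n
      N₁≤m = ℕ.≤-trans (ℕ.m≤m⊔n N₁ N₂) ⊔≤m
      N₂≤n = ℕ.≤-trans (ℕ.m≤n⊔m N₁ N₂) ⊔≤n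
      x-bd = x-close m n (ℕ.≤-trans (ℕ.m≤m⊔n N₃ N₄) ⊔≤m′) (ℕ.≤-trans (ℕ.m≤m⊔n N₃ N₄) ⊔≤n′)
      y-bd = y-close m n (ℕ.≤-trans (ℕ.m≤n⊔m N₃ N₄) ⊔≤m′) (ℕ.≤-trans (ℕ.m≤n⊔m N₃ N₄) ⊔≤n′)
      a = seq x m ; a′ = seq x n ; b = seq y m ; b′ = seq y n
    in begin
      ∣ a * b - a′ * b′ ∣                         ≃⟨ ∣-∣-cong (split a a′ b b′) ⟩
      ∣ a * (b - b′) + b′ * (a - a′) ∣            ≤⟨ ∣p+q∣≤∣p∣+∣q∣ (a * (b - b′)) (b′ * (a - a′)) ⟩
      ∣ a * (b - b′) ∣ + ∣ b′ * (a - a′) ∣        ≤⟨ +-mono-≤ (*-mono-∣∣ a (b - b′) (x≤A m N₁≤m) y-bd)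
                                                             (*-mono-∣∣ b′ (a - a′) (y≤B n N₂≤n) x-bd) ⟩
      A * α + B * β                               ≃⟨ +-cong Aα Bβ ⟩
      ½ * ε + ½ * ε                               ≃⟨ halves ε ⟩
      ε                                           ∎
    where
    open ≤-Reasoning
    open ℚᵘ-Solver.+-*-Solver
    split : ∀ a a′ b b′ → a * b - a′ * b′ ≃ a * (b - b′) + b′ * (a - a′)
    split = solve 4 (λ a a′ b b′ →
      a :* b :- a′ :* b′ := a :* (b :- b′) :+ b′ :* (a :- a′)) ≃-refl
    halves : ∀ ε → ½ * ε + ½ * ε ≃ ε
    halves ε = ≃-trans (≃-sym (*-distribʳ-+ ε ½ ½))
      (≃-trans (*-congʳ {ε} {½ + ½} {1ℚᵘ} (*≡* refl)) (*-identityˡ ε))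

-- largestRoot d a u is the largest r ≤ u with r ^ d ≤ a.
largestRoot : ℕ → ℕ → ℕ → ℕ
largestRoot d a zero    = zero
largestRoot d a (suc u) with suc u ℕ.^ d ℕ.≤? a
... | yes _ = suc u
... | no  _ = largestRoot d a u

⌊root⌋ : ℕ → ℕ → ℕ
⌊root⌋ d a = largestRoot d a a

⌊root⌋-lower : ∀ d .{{_ : ℕ.NonZero d}} a → ⌊root⌋ d a ℕ.^ d ℕ.≤ a
⌊root⌋-lower (suc d) a = go a
  where
  go : ∀ u → largestRoot (suc d) a u ℕ.^ suc d ℕ.≤ a
  go zero    = ℕ.z≤n
  go (suc u) with suc u ℕ.^ suc d ℕ.≤? a
  ... | yes p = p
  ... | no  _ = go u

⌊root⌋-upper : ∀ d .{{_ : ℕ.NonZero d}} a → a ℕ.< suc (⌊root⌋ d a) ℕ.^ d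
⌊root⌋-upper (suc d) a = go a a<
  where
  a< : a ℕ.< suc a ℕ.^ suc d
  a< = ℕ.m≤m*n (suc a) (suc a ℕ.^ d) {{ℕ.m^n≢0 (suc a) d}}
  go : ∀ u → a ℕ.< suc u ℕ.^ suc d → a ℕ.< suc (largestRoot (suc d) a u) ℕ.^ suc d
  go zero    q = q
  go (suc u) q with suc u ℕ.^ suc d ℕ.≤? a
  ... | yes _ = q
  ... | no ¬p = go u (ℕ.≰⇒> ¬p)

rootSeq : ℕ → ℕ → ℕ → ℚᵘ
rootSeq d a n = + ⌊root⌋ d (a ℕ.* suc n ℕ.^ d) / suc n

private
  module _ (d : ℕ) .{{_ : ℕ.NonZero d}} (a : ℕ) where

    R : ℕ → ℕ
    R n = ⌊root⌋ d (a ℕ.* suc n ℕ.^ d)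

    ^-distribʳ-* : ∀ m n e → (m ℕ.* n) ℕ.^ e ≡ m ℕ.^ e ℕ.* n ℕ.^ e
    ^-distribʳ-* m n zero    = refl
    ^-distribʳ-* m n (suc e) rewrite ^-distribʳ-* m n e =
      ℕ.[m*n]*[o*p]≡[m*o]*[n*p] m n (m ℕ.^ e) (n ℕ.^ e)

    cross : ∀ m n → R m ℕ.* suc n ℕ.≤ suc (R n) ℕ.* suc m
    cross m n = ℕ.≮⇒≥ λ gt → ℕ.<-irrefl refl (begin-strict
      (suc (R n) ℕ.* suc m) ℕ.^ d              ≤⟨ ℕ.^-monoˡ-≤ d (ℕ.<⇒≤ gt) ⟩
      (R m ℕ.* suc n) ℕ.^ d                    ≡⟨ ^-distribʳ-* (R m) (suc n) d ⟩
      R m ℕ.^ d ℕ.* suc n ℕ.^ d                ≤⟨ ℕ.*-monoˡ-≤ (suc n ℕ.^ d) (⌊root⌋-lower d (a ℕ.* suc m ℕ.^ d)) ⟩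
      a ℕ.* suc m ℕ.^ d ℕ.* suc n ℕ.^ d        ≡⟨ ℕ.*-assoc a (suc m ℕ.^ d) (suc n ℕ.^ d) ⟩
      a ℕ.* (suc m ℕ.^ d ℕ.* suc n ℕ.^ d)      ≡⟨ cong (a ℕ.*_) (ℕ.*-comm (suc m ℕ.^ d) (suc n ℕ.^ d)) ⟩
      a ℕ.* (suc n ℕ.^ d ℕ.* suc m ℕ.^ d)      ≡⟨ ℕ.*-assoc a (suc n ℕ.^ d) (suc m ℕ.^ d) ⟨
      a ℕ.* suc n ℕ.^ d ℕ.* suc m ℕ.^ d        <⟨ ℕ.*-monoˡ-< (suc m ℕ.^ d) {{ℕ.m^n≢0 (suc m) d}}
                                                    (⌊root⌋-upper d (a ℕ.* suc n ℕ.^ d)) ⟩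
      suc (R n) ℕ.^ d ℕ.* suc m ℕ.^ d          ≡⟨ ^-distribʳ-* (suc (R n)) (suc m) d ⟨
      (suc (R n) ℕ.* suc m) ℕ.^ d              ∎)
      where open ℕ.≤-Reasoning

    add-frac : ∀ r n → + r / suc n + + 1 / suc n ≃ + suc r / suc n
    add-frac r n = *≡* (lemma (+ r) (+ suc n))
      where
      open import Data.Integer.Solver
      open +-*-Solver
      lemma : ∀ r s → (r ℤ.* s ℤ.+ + 1 ℤ.* s) ℤ.* s ≡ (+ 1 ℤ.+ r) ℤ.* (s ℤ.* s)
      lemma = solve 2 (λ r s → (r :* s :+ con (+ 1) :* s) :* s
                             := (con (+ 1) :+ r) :* (s :* s)) refl

    step : ∀ m n → rootSeq d a m ≤ rootSeq d a n + + 1 / suc n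
    step m n = ≤-trans
      (*≤* (subst₂-≤ (ℤ.pos-* (R m) (suc n)) (ℤ.pos-* (suc (R n)) (suc m)) (+≤+ (cross m n))))
      (≤-reflexive (≃-sym (add-frac (R n) n)))
      where
      subst₂-≤ : ∀ {i j k l} → i ≡ j → k ≡ l → i ℤ.≤ k → j ℤ.≤ l
      subst₂-≤ refl refl p = p

    small : ∀ ε → 0ℚᵘ < ε → ∀ n → ↧ₙ ε ℕ.≤ n → + 1 / suc n ≤ ε
    small (mkℚᵘ (+ zero) e)          (*<* (+<+ ()))
    small (mkℚᵘ (+ suc p) e)         _ n e≤n =
      *≤* (+≤+ (ℕ.≤-trans (ℕ.≤-reflexive (ℕ.*-identityˡ (suc e)))
                 (ℕ.≤-trans (ℕ.m≤n⇒m≤1+n e≤n) (ℕ.m≤n*m (suc n) (suc p)))))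
    small (mkℚᵘ (ℤ.-[1+ p ]) e)      (*<* ())

    ∣-∣-bound : ∀ p q ε → p ≤ q + ε → q ≤ p + ε → ∣ p - q ∣ ≤ ε
    ∣-∣-bound p q ε p≤ q≤ with ∣ p - q ∣ | ∣p∣≡p∨∣p∣≡-p (p - q)
    ... | _ | inj₁ refl = ≤-trans (+-monoˡ-≤ (- q) p≤) (≤-reflexive (cancel q ε))
      where
      open ℚᵘ-Solver.+-*-Solver
      cancel : ∀ q ε → (q + ε) - q ≃ ε
      cancel = solve 2 (λ q ε → (q :+ ε) :- q := ε) ≃-refl
    ... | _ | inj₂ refl = ≤-trans (≤-reflexive (flip p q))
                            (≤-trans (+-monoˡ-≤ (- p) q≤) (≤-reflexive (cancel p ε)))
      where
      open ℚᵘ-Solver.+-*-Solver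
      flip : ∀ p q → - (p - q) ≃ q - p
      flip = solve 2 (λ p q → :- (p :- q) := q :- p) ≃-refl
      cancel : ∀ q ε → (q + ε) - q ≃ ε
      cancel = solve 2 (λ q ε → (q :+ ε) :- q := ε) ≃-refl

    root-cauchy : IsCauchy (rootSeq d a)
    root-cauchy ε 0<ε = ↧ₙ ε , λ m n N≤m N≤n →
      ∣-∣-bound (rootSeq d a m) (rootSeq d a n) ε
        (≤-trans (step m n) (+-monoʳ-≤ (rootSeq d a n) (small ε 0<ε n N≤n)))
        (≤-trans (step n m) (+-monoʳ-≤ (rootSeq d a m) (small ε 0<ε m N≤m)))

-- The nonnegative real d-th root of a: the n-th approximation is the
-- largest multiple of 1/(n+1) whose d-th power is at most a.
root : (d : ℕ) .{{_ : ℕ.NonZero d}} → ℕ → ℝ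
root d a = mkℝ (rootSeq d a) (root-cauchy d a)

_^[_/_] : ℕ → ℕ → (d : ℕ) → .{{_ : ℕ.NonZero d}} → ℝ
b ^[ k / d ] = root d (b ℕ.^ k)

-- An edge {i , j} is given by its endpoints in increasing order.
record Edge (n : ℕ) : Set where
  constructor edge
  field
    {lo hi} : Fin n
    lo<hi   : lo Fin.< hi

EdgeColouring : ℕ → ℕ → Set
EdgeColouring n k = Edge n → Fin k

HasMonochromaticTriangle : ∀ {n k} → EdgeColouring n k → Set
HasMonochromaticTriangle {n} c =
  ∃[ u ] ∃[ v ] ∃[ w ] ∃ λ (u<v : u Fin.< v) → ∃ λ (v<w : v Fin.< w) →
    c (edge u<v) ≡ c (edge v<w) × c (edge u<v) ≡ c (edge {n} (Fin.<-trans u<v v<w))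

infix 4 _⟶[3]²_ _↛[3]²_

_⟶[3]²_ : ℕ → ℕ → Set
n ⟶[3]² k = ∀ (c : EdgeColouring n k) → HasMonochromaticTriangle c

_↛[3]²_ : ℕ → ℕ → Set
n ↛[3]² k = ¬ (n ⟶[3]² k)

{-# OPTIONS --safe #-}

-- Colour the edge {i < j} according to j − i; a monochromatic triangle is then
-- a monochromatic solution of x + y = z.  Let T be a set of residues modulo 33
-- whose representatives in {1,…,33} contain no solution of x + y = z, and whose
-- complement is the union of three sets that are sum-free modulo 33.  Colour an
-- integer whose residue lies in one of the three sets by that set, and the
-- other integers d by an old colour of ⌈d / 33⌉.  This adds three colours and
-- multiplies the length of a sum-free colouring by 33, and 33² > 1073.

module Submission where

open import Defs
open import Data.Nat using (ℕ; zero; suc; _+_; _*_; _∸_; _^_; _≤_; _<_; _/_; _%_; NonZero; z≤n; s≤s; _≤?_)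
open import Data.Nat.DivMod using (_mod_; m%n<n; m≡m%n+[m/n]*n; [m+kn]%n≡m%n; +-distrib-/-∣ʳ;
  m/n≡1+[m∸n]/n; m<n⇒m/n≡0; m*n/n≡m; m<n*o⇒m/o<n; m/n*n≤m)
open import Data.Nat.Divisibility using (divides-refl)
open import Data.Nat.Properties
open import Data.Nat.Solver using (module +-*-Solver)
open import Data.Integer as ℤ using (+_; +≤+; +<+)
import Data.Integer.Properties as ℤ
open import Data.Integer.Solver using () renaming (module +-*-Solver to ℤ-Solver)
open import Data.Rational.Unnormalised using (*≤*; *<*; *≡*)
  renaming (_/_ to _/ℚ_; _≤_ to _≤ℚ_; _<_ to _<ℚ_; _≃_ to _≃ℚ_; _+_ to _+ℚ_; _*_ to _*ℚ_)
import Data.Rational.Unnormalised.Properties as ℚᵘ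
open import Data.Fin as Fin using (Fin; toℕ; splitAt; join; inject≤; #_)
import Data.Fin.Properties as Fin
open import Data.Maybe using (Maybe; just; nothing)
open import Data.Maybe.Properties using (≡-dec)
open import Data.Product using (Σ; ∃; ∃-syntax; _×_; _,_; proj₁; proj₂)
open import Data.Sum using (_⊎_; inj₁; inj₂)
open import Data.Sum.Properties using (inj₂-injective)
open import Data.Vec using (Vec; _∷_; []; lookup)
open import Function using (_∘_)
open import Relation.Nullary using (¬_; Dec; yes; no; contradiction; _→-dec_; ¬?)
open import Relation.Nullary.Decidable using (toWitness)
open import Relation.Binary.PropositionalEquality

-- Sum-free colourings and the difference colouring of a complete graph

-- The argument x of a colouring stands for the positive integer x + 1.
SumFree : ∀ {k} → ℕ → (ℕ → Fin k) → Set
SumFree S g = ∀ x y → suc (x + y) < S → g x ≡ g y → ¬ g x ≡ g (suc (x + y))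

SchurColouring : ℕ → ℕ → Set
SchurColouring k S = ∃ λ (g : ℕ → Fin k) → SumFree S g

moreColours : ∀ {j k S} → j ≤ k → SchurColouring j S → SchurColouring k S
moreColours j≤k (g , free) = (λ x → inject≤ (g x) j≤k) , λ x y z<S x~y x~z →
  free x y z<S (Fin.inject≤-injective j≤k j≤k _ _ x~y) (Fin.inject≤-injective j≤k j≤k _ _ x~z)

-- Additivity of differences, (w - u) = (v - u) + (w - v), with each difference d stored as its
-- index d - 1.
∸-suc-split : ∀ {u v w} → u < v → v < w → w ∸ suc u ≡ suc ((v ∸ suc u) + (w ∸ suc v))
∸-suc-split {u} {v} {w} u<v v<w with m≤n⇒∃[o]m+o≡n u<v | m≤n⇒∃[o]m+o≡n v<w
... | x , refl | y , refl = begin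
  suc (suc u + x) + y ∸ suc u                 ≡⟨ cong (_∸ suc u) (cong suc (cong suc (+-assoc u x y))) ⟩
  suc (suc u + (x + y)) ∸ suc u               ≡⟨ cong (_∸ suc u) (+-suc (suc u) (x + y)) ⟨
  suc u + suc (x + y) ∸ suc u                 ≡⟨ m+n∸m≡n (suc u) (suc (x + y)) ⟩
  suc (x + y)                                 ≡⟨ cong₂ (λ a b → suc (a + b)) (m+n∸m≡n (suc u) x) (m+n∸m≡n (suc (suc u + x)) y) ⟨
  suc ((suc u + x ∸ suc u) + (suc (suc u + x) + y ∸ suc (suc u + x))) ∎
  where open ≡-Reasoning

schur⇒↛ : ∀ {k S n} → SchurColouring k S → n ≤ S → n ↛[3]² k
schur⇒↛ {k} {S} {n} (g , free) n≤S arrow with arrow colour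
  where
  colour : EdgeColouring n k
  colour (edge {lo} {hi} _) = g (toℕ hi ∸ suc (toℕ lo))
... | u , v , w , u<v , v<w , uv≡vw , uv≡uw =
  free _ _ z<S uv≡vw (trans uv≡uw (cong g split))
  where
  split = ∸-suc-split u<v v<w
  z<S = subst (_< S) split (≤-<-trans (m∸n≤m (toℕ w) (suc (toℕ u))) (<-≤-trans (Fin.toℕ<n w) n≤S))

-- Templates and the product construction

-- As in SumFree, the index v stands for v + 1; nothing is the special class T.
record Template (p m : ℕ) .{{_ : NonZero m}} : Set where
  _⊞_ : Fin m → Fin m → Fin m
  v ⊞ w = suc (toℕ v + toℕ w) mod m
  field
    class    : Fin m → Maybe (Fin p)
    -- The representatives v + 1 and w + 1 have a sum of index `suc (toℕ v + toℕ w)`. A special sum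
    -- must exceed m, so it carries into a later block.
    special  : ∀ v w → class v ≡ nothing → class w ≡ nothing → class (v ⊞ w) ≡ nothing →
               m ≤ suc (toℕ v + toℕ w)
    ordinary : ∀ v w i → class v ≡ just i → class w ≡ just i → ¬ class (v ⊞ w) ≡ just i

module _ {m : ℕ} .{{_ : NonZero m}} (x y : ℕ) where

  private
    r = suc (x % m + y % m)

    decompose : suc (x + y) ≡ r + (x / m + y / m) * m
    decompose = begin
      suc (x + y)                                      ≡⟨ cong₂ (λ a b → suc (a + b)) (m≡m%n+[m/n]*n x m) (m≡m%n+[m/n]*n y m) ⟩
      suc ((x % m + x / m * m) + (y % m + y / m * m))  ≡⟨ rearrange (x % m) (x / m) (y % m) (y / m) m ⟩
      r + (x / m + y / m) * m                          ∎
      where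
      open ≡-Reasoning
      open +-*-Solver
      rearrange : ∀ a b c d m → suc ((a + b * m) + (c + d * m)) ≡ suc (a + c) + (b + d) * m
      rearrange = solve 5 (λ a b c d m →
        con 1 :+ ((a :+ b :* m) :+ (c :+ d :* m)) := (con 1 :+ (a :+ c)) :+ (b :+ d) :* m) refl

  suc-+-% : suc (x + y) % m ≡ suc (x % m + y % m) % m
  suc-+-% = trans (cong (_% m) decompose) ([m+kn]%n≡m%n r (x / m + y / m) m)

  -- Both remainders are below m, so r lies between m and 2m - 1 and carries exactly once. As
  -- `x / m` is the index of ⌈(x + 1) / m⌉, these block numbers then add.
  suc-+-/ : m ≤ suc (x % m + y % m) → suc (x + y) / m ≡ suc (x / m + y / m)
  suc-+-/ m≤r = begin
    suc (x + y) / m                   ≡⟨ cong (_/ m) decompose ⟩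
    (r + (x / m + y / m) * m) / m     ≡⟨ +-distrib-/-∣ʳ r (divides-refl (x / m + y / m)) ⟩
    r / m + (x / m + y / m) * m / m   ≡⟨ cong₂ _+_ r/m≡1 (m*n/n≡m (x / m + y / m) m) ⟩
    suc (x / m + y / m)               ∎
    where
    open ≡-Reasoning
    r/m≡1 : r / m ≡ 1
    r/m≡1 = trans (m/n≡1+[m∸n]/n m≤r) (cong suc (m<n⇒m/n≡0 (m<n+o⇒m∸n<o r m (<-≤-trans
      (s≤s (+-monoʳ-< (x % m) (m%n<n y m))) (+-monoˡ-≤ m (m%n<n x m))))))

module Extension {p m k S : ℕ} .{{_ : NonZero m}} (T : Template p m) (G : SchurColouring k S) where
  open Template T

  private
    g = proj₁ G
    free = proj₂ G

  colourBy : Maybe (Fin p) → ℕ → Fin p ⊎ Fin k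
  colourBy (just i) u = inj₁ i
  colourBy nothing  u = inj₂ (g u)

  colour : ℕ → Fin p ⊎ Fin k
  colour x = colourBy (class (x mod m)) (x / m)

  toℕ-mod : ∀ x → toℕ (x mod m) ≡ x % m
  toℕ-mod x = Fin.toℕ-fromℕ< (m%n<n x m)

  mod-⊞ : ∀ x y → (x mod m) ⊞ (y mod m) ≡ suc (x + y) mod m
  mod-⊞ x y = Fin.toℕ-injective (begin
    toℕ ((x mod m) ⊞ (y mod m))                       ≡⟨ toℕ-mod (suc (toℕ (x mod m) + toℕ (y mod m))) ⟩
    suc (toℕ (x mod m) + toℕ (y mod m)) % m           ≡⟨ cong₂ (λ a b → suc (a + b) % m) (toℕ-mod x) (toℕ-mod y) ⟩
    suc (x % m + y % m) % m                           ≡⟨ suc-+-% x y ⟨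
    suc (x + y) % m                                   ≡⟨ toℕ-mod (suc (x + y)) ⟨
    toℕ (suc (x + y) mod m)                           ∎)
    where open ≡-Reasoning

  -- Values of `inj₁` and `inj₂` differ, so either all three classes are one ordinary class, which
  -- is excluded modulo m, or all are special. In the second case the sum carries, and the block
  -- numbers solve the same equation monochromatically under the old colouring.
  colour-free : ∀ x y → suc (x + y) < S * m → colour x ≡ colour y → ¬ colour x ≡ colour (suc (x + y))
  colour-free x y z<Sm x~y x~z
    with class (x mod m) in ex | class (y mod m) in ey | class (suc (x + y) mod m) in ez
  colour-free x y z<Sm refl refl | just i | just .i | just .i =
    ordinary _ _ i ex ey (trans (cong class (mod-⊞ x y)) ez)
  colour-free x y z<Sm x~y x~z | nothing | nothing | nothing =
    free (x / m) (y / m) (subst (_< S) carry (m<n*o⇒m/o<n z<Sm)) (inj₂-injective x~y)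
      (trans (inj₂-injective x~z) (cong g carry))
    where
    m≤r = subst (m ≤_) (cong₂ (λ a b → suc (a + b)) (toℕ-mod x) (toℕ-mod y))
            (special _ _ ex ey (trans (cong class (mod-⊞ x y)) ez))
    carry = suc-+-/ x y m≤r

extend : ∀ {p m k S} .{{_ : NonZero m}} → Template p m → SchurColouring k S → SchurColouring (p + k) (S * m)
extend {p} {m} {k} T G = join p k ∘ colour , λ x y z<Sm x~y x~z →
  colour-free x y z<Sm (join-injective x~y) (join-injective x~z)
  where
  open Extension T G
  join-injective : ∀ {a b} → join p k a ≡ join p k b → a ≡ b
  join-injective {a} {b} eq = trans (sym (Fin.splitAt-join p k a)) (trans (cong (splitAt p) eq) (Fin.splitAt-join p k b))

-- The explicit template modulo 33

template₃₃ : Template 3 33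
template₃₃ = record
  { class    = class
  ; special  = toWitness {a? = Fin.all? λ v → Fin.all? λ w →
      (class v ≟ᶜ nothing) →-dec ((class w ≟ᶜ nothing) →-dec ((class (v ⊞ w) ≟ᶜ nothing) →-dec (33 ≤? suc (toℕ v + toℕ w))))} _
  ; ordinary = toWitness {a? = Fin.all? λ v → Fin.all? λ w → Fin.all? λ i →
      (class v ≟ᶜ just i) →-dec ((class w ≟ᶜ just i) →-dec ¬? (class (v ⊞ w) ≟ᶜ just i))} _
  }
  where
  a b c t : Maybe (Fin 3)
  a = just (# 0)
  b = just (# 1)
  c = just (# 2)
  t = nothing

  classes : Vec (Maybe (Fin 3)) 33
  -- The first entry is the class of 1, the last that of 33. The special class is T = {4, 5, 12, 14,
  -- 15, 22, 23, 25, 31, 32, 33}.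
  classes = c ∷ b ∷ c ∷ t ∷ t ∷ b ∷ c ∷ a ∷ b ∷ b ∷ c ∷ t ∷ b ∷ t ∷ t ∷ c ∷ a ∷
            a ∷ a ∷ a ∷ c ∷ t ∷ t ∷ b ∷ t ∷ c ∷ b ∷ b ∷ a ∷ c ∷ t ∷ t ∷ t ∷ []

  class : Fin 33 → Maybe (Fin 3)
  class = lookup classes

  _⊞_ : Fin 33 → Fin 33 → Fin 33
  v ⊞ w = suc (toℕ v + toℕ w) mod 33

  _≟ᶜ_ : (x y : Maybe (Fin 3)) → Dec (x ≡ y)
  _≟ᶜ_ = ≡-dec Fin._≟_

schurPower : ∀ q → SchurColouring (q * 3 + 1) (33 ^ q)
-- In length 1 only the integer 1 counts, and no sum fits.
schurPower zero    = (λ _ → # 0) , λ _ _ → λ { (s≤s ()) }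
schurPower (suc q) = subst (SchurColouring _) (*-comm (33 ^ q) 33) (extend template₃₃ (schurPower q))

-- Powers and truncated roots of naturals

^-distribʳ-* : ∀ m n d → (m * n) ^ d ≡ m ^ d * n ^ d
^-distribʳ-* m n zero    = refl
^-distribʳ-* m n (suc d) rewrite ^-distribʳ-* m n d = [m*n]*[o*p]≡[m*o]*[n*p] m n (m ^ d) (n ^ d)

^-cancelˡ-≤ : ∀ d .{{_ : NonZero d}} {m n} → m ^ d ≤ n ^ d → m ≤ n
^-cancelˡ-≤ d m^d≤n^d = ≮⇒≥ λ n<m → <⇒≱ (^-monoˡ-< d n<m) m^d≤n^d

^-cancelˡ-< : ∀ d {m n} → m ^ d < n ^ d → m < n
^-cancelˡ-< d m^d<n^d = ≰⇒> λ n≤m → <⇒≱ m^d<n^d (^-monoˡ-≤ d n≤m)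

-- (b + 1/s)^d ≤ b^d + K/s, with denominators cleared.
[b+1/s]^d-bound : ∀ b d → ∃ λ K → ∀ s .{{_ : NonZero s}} → suc (b * s) ^ d * s ≤ s ^ d * (b ^ d * s + K)
[b+1/s]^d-bound b zero    = 0 , λ s → ≤-reflexive (sym (trans (+-identityʳ _) (+-identityʳ _)))
[b+1/s]^d-bound b (suc d) with [b+1/s]^d-bound b d
-- (b + 1/s)(b^d + K/s) = b^(d+1) + (bK + b^d)/s + K/s², and K/s² ≤ K/s.
... | K , bound = b * K + b ^ d + K , λ s → begin
  suc (b * s) * suc (b * s) ^ d * s             ≡⟨ *-assoc (suc (b * s)) (suc (b * s) ^ d) s ⟩
  suc (b * s) * (suc (b * s) ^ d * s)           ≤⟨ *-monoʳ-≤ (suc (b * s)) (bound s) ⟩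
  suc (b * s) * (s ^ d * (b ^ d * s + K))       ≡⟨ expand b s (s ^ d) (b ^ d) K ⟩
  s ^ d * (rest s + K)                          ≤⟨ *-monoʳ-≤ (s ^ d) (+-monoʳ-≤ (rest s) (m≤m*n K s)) ⟩
  s ^ d * (rest s + K * s)                      ≡⟨ collect b s (s ^ d) (b ^ d) K ⟩
  s * s ^ d * (b * b ^ d * s + (b * K + b ^ d + K)) ∎
  where
  open ≤-Reasoning
  open +-*-Solver
  rest : ℕ → ℕ
  rest s = b * b ^ d * s * s + b * s * K + b ^ d * s
  expand : ∀ b s p q K → suc (b * s) * (p * (q * s + K)) ≡ p * (b * q * s * s + b * s * K + q * s + K)
  expand = solve 5 (λ b s p q K → (con 1 :+ b :* s) :* (p :* (q :* s :+ K))
    := p :* (b :* q :* s :* s :+ b :* s :* K :+ q :* s :+ K)) refl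
  collect : ∀ b s p q K → p * (b * q * s * s + b * s * K + q * s + K * s) ≡ s * p * (b * q * s + (b * K + q + K))
  collect = solve 5 (λ b s p q K → p :* (b :* q :* s :* s :+ b :* s :* K :+ q :* s :+ K :* s)
    := s :* p :* (b :* q :* s :+ (b :* K :+ q :+ K))) refl

-- If b^d < a then (b + 1/s)^d ≤ a for some s = t + 1.
root-gap : ∀ d {a b} → b ^ d < a → ∃ λ t → suc (b * suc t) ^ d ≤ a * suc t ^ d
root-gap d {a} {b} b^d<a with [b+1/s]^d-bound b d
-- With s = K + 1 the error K/s is below 1, while b^d + 1 ≤ a.
... | K , bound = K , *-cancelʳ-≤ _ _ s (begin
  suc (b * s) ^ d * s        ≤⟨ bound s ⟩
  s ^ d * (b ^ d * s + K)    ≤⟨ *-monoʳ-≤ (s ^ d) (+-monoʳ-≤ (b ^ d * s) (n≤1+n K)) ⟩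
  s ^ d * (b ^ d * s + s)    ≡⟨ cong (s ^ d *_) (+-comm (b ^ d * s) s) ⟩
  s ^ d * (suc (b ^ d) * s)  ≤⟨ *-monoʳ-≤ (s ^ d) (*-monoˡ-≤ s b^d<a) ⟩
  s ^ d * (a * s)            ≡⟨ *-assoc (s ^ d) a s ⟨
  s ^ d * a * s              ≡⟨ cong (_* s) (*-comm (s ^ d) a) ⟩
  a * s ^ d * s              ∎)
  where
  s = suc K
  open ≤-Reasoning

module _ (d : ℕ) .{{_ : NonZero d}} (a T : ℕ) where

  private
    r = ⌊root⌋ d (a * T ^ d)

  ⌊root⌋-scaled-upper : ∀ {b} → a ≤ b ^ d → r ≤ b * T
  ⌊root⌋-scaled-upper {b} a≤b^d = ^-cancelˡ-≤ d (begin
    r ^ d          ≤⟨ ⌊root⌋-lower d (a * T ^ d) ⟩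
    a * T ^ d      ≤⟨ *-monoˡ-≤ (T ^ d) a≤b^d ⟩
    b ^ d * T ^ d  ≡⟨ ^-distribʳ-* b T d ⟨
    (b * T) ^ d    ∎)
    where open ≤-Reasoning

  -- If b + 1/s ≤ a^(1/d) and T ≥ 2s, the truncation error 1/T leaves b + 1/(2s) ≤ r/T.
  ⌊root⌋-scaled-lower : ∀ {b s} .{{_ : NonZero s}} → suc (b * s) ^ d ≤ a * s ^ d → 2 * s ≤ T →
                        suc (b * (2 * s)) * T ≤ r * (2 * s)
  ⌊root⌋-scaled-lower {b} {s} gap 2s≤T = +-cancelˡ-≤ T _ _ (begin
    -- Adding T turns the left side into twice (bs + 1)T, to which the strict bound (bs + 1)T < (r +
    -- 1)s applies. The surplus 2s is at most T.
    T + suc (b * (2 * s)) * T  ≡⟨ double b s T ⟩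
    2 * (suc (b * s) * T)      ≤⟨ *-monoʳ-≤ 2 (<⇒≤ (^-cancelˡ-< d scaled)) ⟩
    2 * (suc r * s)            ≡⟨ undouble r s ⟩
    2 * s + r * (2 * s)        ≤⟨ +-monoˡ-≤ (r * (2 * s)) 2s≤T ⟩
    T + r * (2 * s)            ∎)
    where
    open ≤-Reasoning
    open +-*-Solver
    scaled : (suc (b * s) * T) ^ d < (suc r * s) ^ d
    scaled = begin-strict
      (suc (b * s) * T) ^ d      ≡⟨ ^-distribʳ-* (suc (b * s)) T d ⟩
      suc (b * s) ^ d * T ^ d    ≤⟨ *-monoˡ-≤ (T ^ d) gap ⟩
      a * s ^ d * T ^ d          ≡⟨ swap a (s ^ d) (T ^ d) ⟩
      a * T ^ d * s ^ d          <⟨ *-monoˡ-< (s ^ d) {{m^n≢0 s d}} (⌊root⌋-upper d (a * T ^ d)) ⟩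
      suc r ^ d * s ^ d          ≡⟨ ^-distribʳ-* (suc r) s d ⟨
      (suc r * s) ^ d            ∎
      where
      swap : ∀ a x y → a * x * y ≡ a * y * x
      swap = solve 3 (λ a x y → a :* x :* y := a :* y :* x) refl
    double : ∀ b s T → T + suc (b * (2 * s)) * T ≡ 2 * (suc (b * s) * T)
    double = solve 3 (λ b s T → T :+ (con 1 :+ b :* (con 2 :* s)) :* T := con 2 :* ((con 1 :+ b :* s) :* T)) refl
    undouble : ∀ r s → 2 * (suc r * s) ≡ 2 * s + r * (2 * s)
    undouble = solve 2 (λ r s → con 2 :* ((con 1 :+ r) :* s) := con 2 :* s :+ r :* (con 2 :* s)) refl

-- Comparing a scaled real root with integers

/-mono-cross : ∀ p q r s → p * suc s ≤ r * suc q → + p /ℚ suc q ≤ℚ + r /ℚ suc s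
/-mono-cross p q r s cross = *≤* (subst₂ ℤ._≤_ (ℤ.pos-* p (suc s)) (ℤ.pos-* r (suc q)) (+≤+ cross))

unit-*-/ : ∀ D r n → (+ 1 /ℚ suc D) *ℚ (+ r /ℚ suc n) ≃ℚ + r /ℚ (suc D * suc n)
unit-*-/ D r n = *≡* (cong (ℤ._* + (suc D * suc n)) (ℤ.*-identityˡ (+ r)))

/1-+-unit : ∀ m e → (+ m /ℚ 1) +ℚ (+ 1 /ℚ suc e) ≃ℚ + suc (m * suc e) /ℚ suc e
/1-+-unit m e = *≡* (trans (lemma (+ m) (+ suc e)) (cong (λ x → (+ 1 ℤ.+ x) ℤ.* + (1 * suc e)) (sym (ℤ.pos-* m (suc e)))))
  where
  open ℤ-Solver
  lemma : ∀ x y → (x ℤ.* y ℤ.+ + 1 ℤ.* + 1) ℤ.* y ≡ (+ 1 ℤ.+ x ℤ.* y) ℤ.* (+ 1 ℤ.* y)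
  lemma = solve 2 (λ x y → (x :* y :+ con (+ 1) :* con (+ 1)) :* y := (con (+ 1) :+ x :* y) :* (con (+ 1) :* y)) refl


-- The root exceeds m(D + 1) by at least some 1/s. Half of this absorbs the truncation error, and
-- division by D + 1 leaves the margin 1/(2s(D + 1)).
fromℤ<root : ∀ d .{{_ : NonZero d}} {a} m D → (m * suc D) ^ d < a →
             fromℤ (+ m) <ᴿ fromℚ (+ 1 /ℚ suc D) *ᴿ root d a
fromℤ<root d {a} m D lt with root-gap d {b = m * suc D} lt
... | t , gap = + 1 /ℚ suc e , *<* (+<+ (s≤s z≤n)) , 2s , λ n 2s≤n → begin
    (+ m /ℚ 1) +ℚ (+ 1 /ℚ suc e)            ≃⟨ /1-+-unit m e ⟩
    + suc (m * suc e) /ℚ suc e              ≤⟨ /-mono-cross _ e (r n) _ (cross n (m≤n⇒m≤1+n 2s≤n)) ⟩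
    + r n /ℚ (suc D * suc n)                ≃⟨ unit-*-/ D (r n) n ⟨
    (+ 1 /ℚ suc D) *ℚ (+ r n /ℚ suc n)      ∎
  where
  2s = 2 * suc t
  -- Chosen so that `suc e` reduces to 2s(D + 1).
  e = 2s * suc D ∸ 1
  r = λ n → ⌊root⌋ d (a * suc n ^ d)
  cross : ∀ n → 2s ≤ suc n → suc (m * (2s * suc D)) * (suc D * suc n) ≤ r n * (2s * suc D)
  cross n 2s≤T = N.begin
    suc (m * (2s * suc D)) * (suc D * suc n)    N.≡⟨ regroup m 2s (suc D) (suc n) ⟩
    suc (m * suc D * 2s) * suc n * suc D        N.≤⟨ *-monoˡ-≤ (suc D) (⌊root⌋-scaled-lower d a (suc n) {m * suc D} gap 2s≤T) ⟩
    r n * 2s * suc D                            N.≡⟨ *-assoc (r n) 2s (suc D) ⟩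
    r n * (2s * suc D)                          N.∎
    where
    module N = ≤-Reasoning
    open +-*-Solver
    regroup : ∀ m x D T → suc (m * (x * D)) * (D * T) ≡ suc (m * D * x) * T * D
    regroup = solve 4 (λ m x D T → (con 1 :+ m :* (x :* D)) :* (D :* T) := (con 1 :+ m :* D :* x) :* T :* D) refl
  open ℚᵘ.≤-Reasoning

-- Every truncated root is at most n(D + 1), so a witness of the reverse strict inequality is
-- refuted at its own index N.
root≤fromℤ : ∀ d .{{_ : NonZero d}} {a} n D → a ≤ (n * suc D) ^ d →
             fromℚ (+ 1 /ℚ suc D) *ᴿ root d a ≤ᴿ fromℤ (+ n)
root≤fromℤ d {a} n D a≤ (ε , 0<ε , N , above) = ℚᵘ.<⇒≱ n<n+ε (begin
    (+ n /ℚ 1) +ℚ ε                         ≤⟨ above N ≤-refl ⟩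
    (+ 1 /ℚ suc D) *ℚ (+ r /ℚ suc N)        ≃⟨ unit-*-/ D r N ⟩
    + r /ℚ (suc D * suc N)                  ≤⟨ /-mono-cross r _ n 0 cross ⟩
    + n /ℚ 1                                ∎)
  where
  r = ⌊root⌋ d (a * suc N ^ d)
  cross : r * 1 ≤ n * (suc D * suc N)
  cross = ≤-trans (≤-reflexive (*-identityʳ r))
    (≤-trans (⌊root⌋-scaled-upper d a (suc N) a≤) (≤-reflexive (*-assoc n (suc D) (suc N))))
  n<n+ε : (+ n /ℚ 1) <ℚ (+ n /ℚ 1) +ℚ ε
  n<n+ε = ℚᵘ.<-respˡ-≃ (ℚᵘ.+-identityʳ (+ n /ℚ 1)) (ℚᵘ.+-monoʳ-< (+ n /ℚ 1) 0<ε)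
  open ℚᵘ.≤-Reasoning

-- Locating the ceiling

crossing : ∀ (f : ℕ → ℕ) {a} M → f 0 < a → a ≤ f M → ∃ λ m → m < M × f m < a × a ≤ f (suc m)
crossing f zero    f0<a a≤f0 = contradiction a≤f0 (<⇒≱ f0<a)
crossing f {a} (suc M) f0<a a≤fM with a ≤? f M
... | no  a≰fM = M , ≤-refl , ≰⇒> a≰fM , a≤fM
... | yes a≤fM′ with crossing f M f0<a a≤fM′
...   | m , m<M , bounds = m , m<n⇒m<1+n m<M , bounds

-- The scaled root lies in (m, m + 1] once (m(D + 1))^d < a ≤ ((m + 1)(D + 1))^d. These are
-- decidable conditions on naturals, so a finite search below M finds the ceiling m + 1.
ceiling-bounded : ∀ d .{{_ : NonZero d}} {a} D M → 0 < a → a ≤ (M * suc D) ^ d →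
                  ∃ λ n → IsCeiling (fromℚ (+ 1 /ℚ suc D) *ᴿ root d a) (+ n) × n ≤ M
-- Exposing d as a successor makes `(0 * suc D) ^ d` reduce to 0, so `0<a` starts the search.
ceiling-bounded d@(suc _) D M 0<a a≤ with crossing (λ m → (m * suc D) ^ d) M 0<a a≤
... | m , m<M , below , above = suc m , (fromℤ<root d m D below , root≤fromℤ d (suc m) D above) , m<M

-- The numerical bound and the choice of C

-- For k = j + 1 and q = ⌊j/3⌋ this is the sixth power of 1073^(k/6) ≤ 33 · 33^q. It holds since k ≤
-- 3(q + 1) and 1073³ ≤ 33⁶, as 33² = 1089.
1073-power-bound : ∀ j → 1073 ^ suc j ≤ (33 ^ (j / 3) * 33) ^ 6
1073-power-bound j = begin
  1073 ^ suc j               ≤⟨ ^-monoʳ-≤ 1073 j<3[q+1] ⟩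
  1073 ^ (3 * suc q)         ≡⟨ ^-*-assoc 1073 3 (suc q) ⟨
  (1073 ^ 3) ^ suc q         ≤⟨ ^-monoˡ-≤ (suc q) (toWitness {a? = 1073 ^ 3 ≤? 33 ^ 6} _) ⟩
  (33 ^ 6) ^ suc q           ≡⟨ ^-*-assoc 33 6 (suc q) ⟩
  33 ^ (6 * suc q)           ≡⟨ cong (33 ^_) (*-comm 6 (suc q)) ⟩
  33 ^ (suc q * 6)           ≡⟨ ^-*-assoc 33 (suc q) 6 ⟨
  (33 * 33 ^ q) ^ 6          ≡⟨ cong (_^ 6) (*-comm 33 (33 ^ q)) ⟩
  (33 ^ q * 33) ^ 6          ∎
  where
  open ≤-Reasoning
  q = j / 3
  j<3[q+1] : j < 3 * suc q
  j<3[q+1] = begin-strict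
    j                ≡⟨ m≡m%n+[m/n]*n j 3 ⟩
    j % 3 + q * 3    <⟨ +-monoˡ-< (q * 3) (m%n<n j 3) ⟩
    3 + q * 3        ≡⟨ *-comm (suc q) 3 ⟩
    3 * suc q        ∎

theoremB1 : Σ ℝ λ C → 0ᴿ <ᴿ C ×
    (∀ (k : ℕ) → 2 ≤ k →
    ∃[ n ] IsCeiling (C *ᴿ (1073 ^[ k / 6 ])) (+ n) × n ↛[3]² k)
-- The factor 1/33 pays for rounding the number of template steps down to a whole number.
theoremB1 = fromℚ 1/33 , (1/33 , *<* (+<+ (s≤s z≤n)) , 0 , λ _ _ → ℚᵘ.≤-reflexive (ℚᵘ.+-identityˡ 1/33)) ,
  λ { (suc j) _ →
    -- One of the k = j + 1 colours serves the base colouring; the other j allow q template steps,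
    -- since 3q + 1 ≤ k.
    let q = j / 3
        colouring = moreColours (≤-trans (≤-reflexive (+-comm (q * 3) 1)) (s≤s (m/n*n≤m j 3))) (schurPower q)
        -- The argument 32 stands for the denominator 33 = `suc 32`.
        n , ceiling , n≤33^q = ceiling-bounded 6 32 (33 ^ q) (m^n>0 1073 (suc j)) (1073-power-bound j)
    in n , ceiling , schur⇒↛ colouring n≤33^q }
  where
  1/33 = + 1 /ℚ 33
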